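{- Over $\mathrm{HA}^\omega + \mathrm{BI}$, the explicitly controlled product of selection functions $\mathsf{eps}$ is $T$-definable from the explicitly controlled product of quantifiers $\mathsf{epq}$; that is, $\mathsf{epq} \geq_T \mathsf{eps}$.
   Context: Types and systems. Finite types are generated from $\mathbb{B}$ (booleans) and $\mathbb{N}$ by $X\times Y$, $X\to Y$ and $X^*$ (finite sequences). For a sequence of types $(X_i)_{i\in\mathbb{N}}$, $\Pi_i X_i$ is the type of infinite sequences whose $i$-th entry is in $X_i$, $\Pi_{i<n}X_i$ the type of finite sequences of length $n$, and $\Pi_{i\ge k}X_i$ means $\Pi_i X_{i+k}$. (This is used for readability; one may take all $X_i$ equal to one type $X$, reading $\Pi_iX_i$ as $\mathbb{N}\to X$ and finite sequence types as $X^*$.) $\mathrm{HA}^\omega$ is Heyting arithmetic in all finite types with fully extensional equality (Troelstra's E-$\mathrm{HA}^\omega$); system $T$ is its quantifier-free fragment (Gödel's primitive recursive functionals). $\mathbf{0}$ denotes the canonical zero object of each type (the zero sequence for sequence types). Notation. $*$ is concatenation (of finite sequences, elements, and a finite with an infinite sequence). For $q\colon\Pi_{i\ge n}X_i\to R$ and $x\colon X_n$, $q_x(\alpha)=q(x*\alpha)$. $J_RX = (X\to R)\to X$ (selection functions), $K_RX=(X\to R)\to R$ (quantifiers). $T$-definability. A functional is specified by a defining equation (for each choice of type parameters). $G$ is $T$-definable from $F$ over a theory $\mathcal{S}$ (written $F\ge_T G$) if for each choice of types for $G$ there are a choice of types for $F$ and a term $s$ of system $T$ such that $s(F)$ satisfies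 the defining equation of $G$, provably in $\mathcal{S}$ together with the defining equation of $F$. $\mathsf{eps}$. For $\varepsilon\colon\Pi_kJ_RX_k$, $\ell\colon R\to\mathbb{N}$, $q\colon\Pi_iX_{i+n}\to R$, the value $\mathsf{eps}^\ell_n(\varepsilon)(q)\colon\Pi_iX_{i+n}$ is specified by: $\mathsf{eps}^\ell_n(\varepsilon)(q)=\mathbf{0}$ if $\ell(q(\mathbf{0}))<n$, and otherwise $\mathsf{eps}^\ell_n(\varepsilon)(q)=c*\mathsf{eps}^\ell_{n+1}(\varepsilon)(q_c)$, where $c=\varepsilon_n(\lambda x.\,q_x(\mathsf{eps}^\ell_{n+1}(\varepsilon)(q_x)))$. $\mathsf{epq}$. For $\phi\colon\Pi_kK_RX_k$, $\ell\colon R\to\mathbb{N}$, $q\colon\Pi_iX_{i+n}\to R$, the value $\mathsf{epq}^\ell_n(\phi)(q)\colon R$ is specified by: $\mathsf{epq}^\ell_n(\phi)(q)=q(\mathbf{0})$ if $\ell(q(\mathbf{0}))<n$, and otherwise $\mathsf{epq}^\ell_n(\phi)(q)=\phi_n(\lambda x^{X_n}.\,\mathsf{epq}^\ell_{n+1}(\phi)(q_x))$. $\mathrm{BI}$ (relativised bar induction) is the scheme, for arbitrary predicates $S,P$ on finite sequences: if $S(\langle\rangle)$, and for every infinite $\alpha$ with $S([\alpha](n))$ for all $n$ there is $n$ with $P([\alpha](n))$, and for all $s$ with $S(s)$: $\forall x[S(s*x)\to P(s*x)]\to P(s)$; then $P(\langle\rangle)$. Here $[\alpha](n)=\langle\alpha(0),\dots,\alpha(n-1)\rangle$.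 -}

module Defs where

open import Data.List using (List; []; _∷_; map)
open import Data.List.Membership.Propositional using (_∈_)
open import Data.List.Relation.Unary.Any using (here; there)
open import Data.Product using (_×_; _,_; ∃-syntax)
open import Data.Sum using (_⊎_)
open import Function using (_∘_)
open import Relation.Binary.PropositionalEquality using (refl)

infixr 20 _⇒_
infixr 21 _⊗_
infix  22 _⋆

data Ty : Set where
  𝔹 𝐍 : Ty
  _⊗_ : Ty → Ty → Ty
  _⇒_ : Ty → Ty → Ty
  _⋆  : Ty → Ty

Ctx : Set
Ctx = List Ty

variable
  Γ Γ′ : Ctx
  σ τ X R : Ty

------------------------------------------------------------------------
-- System T: intrinsically typed λ-terms, variables as de Bruijn indices.

infixl 15 _·_
infixl 16 _∷ʳ_

data Tm (Γ : Ctx) : Ty → Set where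
  var   : σ ∈ Γ → Tm Γ σ
  ƛ     : Tm (σ ∷ Γ) τ → Tm Γ (σ ⇒ τ)
  _·_   : Tm Γ (σ ⇒ τ) → Tm Γ σ → Tm Γ τ
  true  : Tm Γ 𝔹
  false : Tm Γ 𝔹
  if    : Tm Γ 𝔹 → Tm Γ σ → Tm Γ σ → Tm Γ σ
  zero  : Tm Γ 𝐍
  suc   : Tm Γ 𝐍 → Tm Γ 𝐍
  rec   : Tm Γ σ → Tm Γ (𝐍 ⇒ σ ⇒ σ) → Tm Γ 𝐍 → Tm Γ σ
  pair  : Tm Γ σ → Tm Γ τ → Tm Γ (σ ⊗ τ)
  fst   : Tm Γ (σ ⊗ τ) → Tm Γ σ
  snd   : Tm Γ (σ ⊗ τ) → Tm Γ τ
  -- Finite sequences are generated from the empty one by s , x ↦ s * x,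
  -- i.e. they grow on the right, as in bar induction.
  ⟨⟩    : Tm Γ (σ ⋆)
  _∷ʳ_  : Tm Γ (σ ⋆) → Tm Γ σ → Tm Γ (σ ⋆)
  rec⋆  : Tm Γ τ → Tm Γ (σ ⋆ ⇒ σ ⇒ τ ⇒ τ) → Tm Γ (σ ⋆) → Tm Γ τ

Ren : Ctx → Ctx → Set
Ren Γ Γ′ = ∀ {σ} → σ ∈ Γ → σ ∈ Γ′

Sub : Ctx → Ctx → Set
Sub Γ Γ′ = ∀ {σ} → σ ∈ Γ → Tm Γ′ σ

lift-ren : Ren Γ Γ′ → Ren (σ ∷ Γ) (σ ∷ Γ′)
lift-ren ρ (here e)  = here e
lift-ren ρ (there x) = there (ρ x)

ren : Ren Γ Γ′ → Tm Γ σ → Tm Γ′ σ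
ren ρ (var x)      = var (ρ x)
ren ρ (ƛ t)        = ƛ (ren (lift-ren ρ) t)
ren ρ (t · u)      = ren ρ t · ren ρ u
ren ρ true         = true
ren ρ false        = false
ren ρ (if b t u)   = if (ren ρ b) (ren ρ t) (ren ρ u)
ren ρ zero         = zero
ren ρ (suc t)      = suc (ren ρ t)
ren ρ (rec z f n)  = rec (ren ρ z) (ren ρ f) (ren ρ n)
ren ρ (pair t u)   = pair (ren ρ t) (ren ρ u)
ren ρ (fst t)      = fst (ren ρ t)
ren ρ (snd t)      = snd (ren ρ t)
ren ρ ⟨⟩           = ⟨⟩
ren ρ (s ∷ʳ x)     = ren ρ s ∷ʳ ren ρ x
ren ρ (rec⋆ z f s) = rec⋆ (ren ρ z) (ren ρ f) (ren ρ s)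

infixl 10 _▸_

_▸_ : Sub Γ Γ′ → Tm Γ′ σ → Sub (σ ∷ Γ) Γ′
(θ ▸ t) (here refl) = t
(θ ▸ t) (there x)   = θ x

lift-sub : Sub Γ Γ′ → Sub (σ ∷ Γ) (σ ∷ Γ′)
lift-sub θ = (ren there ∘ θ) ▸ var (here refl)

sub : Sub Γ Γ′ → Tm Γ σ → Tm Γ′ σ
sub θ (var x)      = θ x
sub θ (ƛ t)        = ƛ (sub (lift-sub θ) t)
sub θ (t · u)      = sub θ t · sub θ u
sub θ true         = true
sub θ false        = false
sub θ (if b t u)   = if (sub θ b) (sub θ t) (sub θ u)
sub θ zero         = zero
sub θ (suc t)      = suc (sub θ t)
sub θ (rec z f n)  = rec (sub θ z) (sub θ f) (sub θ n)
sub θ (pair t u)   = pair (sub θ t) (sub θ u)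
sub θ (fst t)      = fst (sub θ t)
sub θ (snd t)      = snd (sub θ t)
sub θ ⟨⟩           = ⟨⟩
sub θ (s ∷ʳ x)     = sub θ s ∷ʳ sub θ x
sub θ (rec⋆ z f s) = rec⋆ (sub θ z) (sub θ f) (sub θ s)

infix 25 _[_]

_[_] : Tm (σ ∷ Γ) τ → Tm Γ σ → Tm Γ τ
t [ u ] = sub (var ▸ u) t

v₀ : ∀ {σ₀} → Tm (σ₀ ∷ Γ) σ₀
v₀ = var (here refl)

v₁ : ∀ {σ₀ σ₁} → Tm (σ₀ ∷ σ₁ ∷ Γ) σ₁
v₁ = var (there (here refl))

v₂ : ∀ {σ₀ σ₁ σ₂} → Tm (σ₀ ∷ σ₁ ∷ σ₂ ∷ Γ) σ₂
v₂ = var (there (there (here refl)))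

v₃ : ∀ {σ₀ σ₁ σ₂ σ₃} → Tm (σ₀ ∷ σ₁ ∷ σ₂ ∷ σ₃ ∷ Γ) σ₃
v₃ = var (there (there (there (here refl))))

v₄ : ∀ {σ₀ σ₁ σ₂ σ₃ σ₄} → Tm (σ₀ ∷ σ₁ ∷ σ₂ ∷ σ₃ ∷ σ₄ ∷ Γ) σ₄
v₄ = var (there (there (there (there (here refl)))))

v₅ : ∀ {σ₀ σ₁ σ₂ σ₃ σ₄ σ₅} → Tm (σ₀ ∷ σ₁ ∷ σ₂ ∷ σ₃ ∷ σ₄ ∷ σ₅ ∷ Γ) σ₅
v₅ = var (there (there (there (there (there (here refl))))))

𝟎 : ∀ σ → Tm Γ σ
𝟎 𝔹       = false
𝟎 𝐍       = zero
𝟎 (σ ⊗ τ) = pair (𝟎 σ) (𝟎 τ)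
𝟎 (σ ⇒ τ) = ƛ (𝟎 τ)
𝟎 (σ ⋆)   = ⟨⟩

-- m < n, by recursion on m and case distinction on n.
less : Tm Γ (𝐍 ⇒ 𝐍 ⇒ 𝔹)
less = ƛ (rec (ƛ (rec false (ƛ (ƛ true)) v₀))
              (ƛ (ƛ (ƛ (rec false (ƛ (ƛ (v₃ · v₁))) v₀))))
              v₀)

-- Infinite sequences over X have type 𝐍 ⇒ X; this is x , α ↦ x * α.
cons : Tm Γ (X ⇒ (𝐍 ⇒ X) ⇒ 𝐍 ⇒ X)
cons = ƛ (ƛ (ƛ (rec v₂ (ƛ (ƛ (v₃ · v₁))) v₀)))

-- q , x ↦ q_x
slice : Tm Γ (((𝐍 ⇒ X) ⇒ R) ⇒ X ⇒ (𝐍 ⇒ X) ⇒ R)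
slice = ƛ (ƛ (ƛ (v₂ · (cons · v₁ · v₀))))

-- α , n ↦ [α](n)
initial : Tm Γ ((𝐍 ⇒ X) ⇒ 𝐍 ⇒ X ⋆)
initial = ƛ (ƛ (rec ⟨⟩ (ƛ (ƛ (v₀ ∷ʳ (v₃ · v₁)))) v₀))

------------------------------------------------------------------------
-- Many-sorted intuitionistic logic, with an equality predicate at every
-- finite type.

infix  9 _≐_
infixr 8 _∧̇_
infixr 7 _∨̇_
infixr 6 _⊃_

data Fm (Γ : Ctx) : Set where
  _≐_          : Tm Γ σ → Tm Γ σ → Fm Γ
  ⊥̇            : Fm Γ
  _∧̇_ _∨̇_ _⊃_  : Fm Γ → Fm Γ → Fm Γ
  ∀̇ ∃̇          : ∀ σ → Fm (σ ∷ Γ) → Fm Γ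

renF : Ren Γ Γ′ → Fm Γ → Fm Γ′
renF ρ (t ≐ u)  = ren ρ t ≐ ren ρ u
renF ρ ⊥̇        = ⊥̇
renF ρ (φ ∧̇ ψ)  = renF ρ φ ∧̇ renF ρ ψ
renF ρ (φ ∨̇ ψ)  = renF ρ φ ∨̇ renF ρ ψ
renF ρ (φ ⊃ ψ)  = renF ρ φ ⊃ renF ρ ψ
renF ρ (∀̇ σ φ)  = ∀̇ σ (renF (lift-ren ρ) φ)
renF ρ (∃̇ σ φ)  = ∃̇ σ (renF (lift-ren ρ) φ)

subF : Sub Γ Γ′ → Fm Γ → Fm Γ′
subF θ (t ≐ u)  = sub θ t ≐ sub θ u
subF θ ⊥̇        = ⊥̇
subF θ (φ ∧̇ ψ)  = subF θ φ ∧̇ subF θ ψ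
subF θ (φ ∨̇ ψ)  = subF θ φ ∨̇ subF θ ψ
subF θ (φ ⊃ ψ)  = subF θ φ ⊃ subF θ ψ
subF θ (∀̇ σ φ)  = ∀̇ σ (subF (lift-sub θ) φ)
subF θ (∃̇ σ φ)  = ∃̇ σ (subF (lift-sub θ) φ)

infix 25 _[_]F _⟨_∣_⟩

_[_]F : Fm (σ ∷ Γ) → Tm Γ σ → Fm Γ
φ [ t ]F = subF (var ▸ t) φ

-- φ(t), where t lives in a context extending that of the parameters of φ.
_⟨_∣_⟩ : Fm (σ ∷ Γ) → Ren Γ Γ′ → Tm Γ′ σ → Fm Γ′
φ ⟨ ρ ∣ t ⟩ = subF ((var ∘ ρ) ▸ t) φ

Theory : Set₁
Theory = ∀ {Γ} → Fm Γ → Set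

infixr 5 _∪_

_∪_ : Theory → Theory → Theory
(𝒮 ∪ 𝒯) φ = 𝒮 φ ⊎ 𝒯 φ

infix 3 _∣_⊢_

data _∣_⊢_ (𝒮 : Theory) {Γ : Ctx} (Δ : List (Fm Γ)) : Fm Γ → Set where
  axiom : ∀ {φ} → 𝒮 φ → 𝒮 ∣ Δ ⊢ φ
  hyp   : ∀ {φ} → φ ∈ Δ → 𝒮 ∣ Δ ⊢ φ
  ⊥E    : ∀ {φ} → 𝒮 ∣ Δ ⊢ ⊥̇ → 𝒮 ∣ Δ ⊢ φ
  ∧I    : ∀ {φ ψ} → 𝒮 ∣ Δ ⊢ φ → 𝒮 ∣ Δ ⊢ ψ → 𝒮 ∣ Δ ⊢ φ ∧̇ ψ
  ∧E₁   : ∀ {φ ψ} → 𝒮 ∣ Δ ⊢ φ ∧̇ ψ → 𝒮 ∣ Δ ⊢ φ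
  ∧E₂   : ∀ {φ ψ} → 𝒮 ∣ Δ ⊢ φ ∧̇ ψ → 𝒮 ∣ Δ ⊢ ψ
  ∨I₁   : ∀ {φ ψ} → 𝒮 ∣ Δ ⊢ φ → 𝒮 ∣ Δ ⊢ φ ∨̇ ψ
  ∨I₂   : ∀ {φ ψ} → 𝒮 ∣ Δ ⊢ ψ → 𝒮 ∣ Δ ⊢ φ ∨̇ ψ
  ∨E    : ∀ {φ ψ χ} → 𝒮 ∣ Δ ⊢ φ ∨̇ ψ → 𝒮 ∣ φ ∷ Δ ⊢ χ → 𝒮 ∣ ψ ∷ Δ ⊢ χ →
          𝒮 ∣ Δ ⊢ χ
  ⊃I    : ∀ {φ ψ} → 𝒮 ∣ φ ∷ Δ ⊢ ψ → 𝒮 ∣ Δ ⊢ φ ⊃ ψ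
  ⊃E    : ∀ {φ ψ} → 𝒮 ∣ Δ ⊢ φ ⊃ ψ → 𝒮 ∣ Δ ⊢ φ → 𝒮 ∣ Δ ⊢ ψ
  ∀I    : ∀ {φ} → 𝒮 ∣ map (renF there) Δ ⊢ φ → 𝒮 ∣ Δ ⊢ ∀̇ σ φ
  ∀E    : ∀ {φ} → 𝒮 ∣ Δ ⊢ ∀̇ σ φ → (t : Tm Γ σ) → 𝒮 ∣ Δ ⊢ φ [ t ]F
  ∃I    : ∀ {φ} (t : Tm Γ σ) → 𝒮 ∣ Δ ⊢ φ [ t ]F → 𝒮 ∣ Δ ⊢ ∃̇ σ φ
  ∃E    : ∀ {φ ψ} → 𝒮 ∣ Δ ⊢ ∃̇ σ φ →
          𝒮 ∣ φ ∷ map (renF there) Δ ⊢ renF there ψ → 𝒮 ∣ Δ ⊢ ψ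

------------------------------------------------------------------------
-- HA^ω. Equality is a congruence by ≐-subst, and fully extensional by ext.

data HAω {Γ : Ctx} : Fm Γ → Set where
  ≐-refl  : (t : Tm Γ σ) → HAω (t ≐ t)
  ≐-subst : (φ : Fm (σ ∷ Γ)) (t u : Tm Γ σ) →
            HAω (t ≐ u ⊃ φ [ t ]F ⊃ φ [ u ]F)
  ext     : (f g : Tm Γ (σ ⇒ τ)) →
            HAω (∀̇ σ (ren there f · v₀ ≐ ren there g · v₀) ⊃ f ≐ g)

  β         : (t : Tm (σ ∷ Γ) τ) (u : Tm Γ σ) → HAω (ƛ t · u ≐ t [ u ])
  if-true   : (t u : Tm Γ σ) → HAω (if true t u ≐ t)
  if-false  : (t u : Tm Γ σ) → HAω (if false t u ≐ u)
  rec-zero  : (z : Tm Γ σ) (f : Tm Γ (𝐍 ⇒ σ ⇒ σ)) →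
              HAω (rec z f zero ≐ z)
  rec-suc   : (z : Tm Γ σ) (f : Tm Γ (𝐍 ⇒ σ ⇒ σ)) (n : Tm Γ 𝐍) →
              HAω (rec z f (suc n) ≐ f · n · rec z f n)
  fst-pair  : (t : Tm Γ σ) (u : Tm Γ τ) → HAω (fst (pair t u) ≐ t)
  snd-pair  : (t : Tm Γ σ) (u : Tm Γ τ) → HAω (snd (pair t u) ≐ u)
  pair-η    : (p : Tm Γ (σ ⊗ τ)) → HAω (pair (fst p) (snd p) ≐ p)
  rec⋆-⟨⟩   : (z : Tm Γ τ) (f : Tm Γ (σ ⋆ ⇒ σ ⇒ τ ⇒ τ)) →
              HAω (rec⋆ z f ⟨⟩ ≐ z)
  rec⋆-∷ʳ   : (z : Tm Γ τ) (f : Tm Γ (σ ⋆ ⇒ σ ⇒ τ ⇒ τ))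
              (s : Tm Γ (σ ⋆)) (x : Tm Γ σ) →
              HAω (rec⋆ z f (s ∷ʳ x) ≐ f · s · x · rec⋆ z f s)

  suc≢zero : (n : Tm Γ 𝐍) → HAω (suc n ≐ zero ⊃ ⊥̇)
  suc-inj  : (m n : Tm Γ 𝐍) → HAω (suc m ≐ suc n ⊃ m ≐ n)

  ind-𝔹 : (φ : Fm (𝔹 ∷ Γ)) → HAω (φ [ true ]F ⊃ φ [ false ]F ⊃ ∀̇ 𝔹 φ)
  ind-𝐍 : (φ : Fm (𝐍 ∷ Γ)) →
          HAω (φ [ zero ]F ⊃ ∀̇ 𝐍 (φ ⊃ φ ⟨ there ∣ suc v₀ ⟩) ⊃ ∀̇ 𝐍 φ)
  ind-⋆ : (φ : Fm (σ ⋆ ∷ Γ)) →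
          HAω (φ [ ⟨⟩ ]F ⊃
               ∀̇ (σ ⋆) (φ ⊃ ∀̇ σ (φ ⟨ there ∘ there ∣ v₁ ∷ʳ v₀ ⟩)) ⊃
               ∀̇ (σ ⋆) φ)

-- The scheme of relativised bar induction; S and P may have parameters.
data BI {Γ : Ctx} : Fm Γ → Set where
  bi : (S P : Fm (X ⋆ ∷ Γ)) →
       BI (S [ ⟨⟩ ]F ⊃
           ∀̇ (𝐍 ⇒ X)
             (∀̇ 𝐍 (S ⟨ there ∘ there ∣ initial · v₁ · v₀ ⟩) ⊃
              ∃̇ 𝐍 (P ⟨ there ∘ there ∣ initial · v₁ · v₀ ⟩)) ⊃
           ∀̇ (X ⋆)
             (S ⊃
              ∀̇ X (S ⟨ there ∘ there ∣ v₁ ∷ʳ v₀ ⟩ ⊃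
                   P ⟨ there ∘ there ∣ v₁ ∷ʳ v₀ ⟩) ⊃
              P) ⊃
           P [ ⟨⟩ ]F)

------------------------------------------------------------------------
-- T-definability

-- For each choice of type parameters, a type and a defining equation whose
-- only free variable stands for the functional being specified.
record Functional : Set₁ where
  field
    Params : Set
    type   : Params → Ty
    eqn    : (p : Params) → Fm (type p ∷ [])

infix 4 _≥T_over_

_≥T_over_ : Functional → Functional → Theory → Set
F ≥T G over 𝒮 =
  (g : G.Params) →
  ∃[ f ] ∃[ s ] 𝒮 ∣ F.eqn f ∷ [] ⊢ G.eqn g ⟨ (λ ()) ∣ applied f g s ⟩
  where
  module F = Functional F
  module G = Functional G

  applied : ∀ f g → Tm [] (F.type f ⇒ G.type g) → Tm (F.type f ∷ []) (G.type g)
  applied f g s = ren (λ ()) s · v₀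

------------------------------------------------------------------------
-- The products of selection functions and of quantifiers. All the types
-- X_i are taken equal to one type X, so Π_i X_{i+n} is 𝐍 ⇒ X for every n,
-- and the type parameters are (X , R). The arguments of both functionals
-- come in the order ℓ, n, ε (respectively φ), q.

J K : Ty → Ty → Ty
J R X = (X ⇒ R) ⇒ X
K R X = (X ⇒ R) ⇒ R

eps : Functional
eps = record
  { Params = Ty × Ty
  ; type   = λ (X , R) →
      (R ⇒ 𝐍) ⇒ 𝐍 ⇒ (𝐍 ⇒ J R X) ⇒ ((𝐍 ⇒ X) ⇒ R) ⇒ 𝐍 ⇒ X
  ; eqn    = λ (X , R) →
      ∀̇ (R ⇒ 𝐍) (∀̇ 𝐍 (∀̇ (𝐍 ⇒ J R X) (∀̇ ((𝐍 ⇒ X) ⇒ R)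
        (let EPS = v₄; ℓ = v₃; n = v₂; ε = v₁; q = v₀
             c = ε · n · ƛ (let EPS = v₅; ℓ = v₄; n = v₃; ε = v₂; q = v₁; x = v₀
                            in slice · q · x
                                 · (EPS · ℓ · suc n · ε · (slice · q · x)))
         in EPS · ℓ · n · ε · q
            ≐ if (less · (ℓ · (q · 𝟎 (𝐍 ⇒ X))) · n)
                 (𝟎 (𝐍 ⇒ X))
                 (cons · c · (EPS · ℓ · suc n · ε · (slice · q · c)))))))
  }

epq : Functional
epq = record
  { Params = Ty × Ty
  ; type   = λ (X , R) →
      (R ⇒ 𝐍) ⇒ 𝐍 ⇒ (𝐍 ⇒ K R X) ⇒ ((𝐍 ⇒ X) ⇒ R) ⇒ R
  ; eqn    = λ (X , R) →
      ∀̇ (R ⇒ 𝐍) (∀̇ 𝐍 (∀̇ (𝐍 ⇒ K R X) (∀̇ ((𝐍 ⇒ X) ⇒ R)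
        (let EPQ = v₄; ℓ = v₃; n = v₂; φ = v₁; q = v₀
         in EPQ · ℓ · n · φ · q
            ≐ if (less · (ℓ · (q · 𝟎 (𝐍 ⇒ X))) · n)
                 (q · 𝟎 (𝐍 ⇒ X))
                 (φ · n · ƛ (let EPQ = v₅; ℓ = v₄; n = v₃; φ = v₂; q = v₁; x = v₀
                             in EPQ · ℓ · suc n · φ · (slice · q · x)))))))
  }

{-# OPTIONS --safe #-}

-- Use epq with result type Y = X^ℕ × ℕ. The quantifiers
-- φ_k(p) = p(ε_k(λ x. q(fst(p x)))) make epq return the play computed by eps,
-- so eps_n(ε)(q) = fst(epq_n(φ)(λ α. ⟨α , 0⟩)) with control ℓ ∘ q ∘ fst. The
-- equation of eps reduces to the statement that playing q after a move x is x
-- followed by a play of q_x, which is shown by bar induction on the further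
-- moves s. That every α eventually meets the stopping condition is Kreisel's
-- trick, for which the component ℕ is there: with quantifiers that follow α and
-- add one to the second component at each round, the value V_j of epq after
-- [α](j) satisfies V_j = V_{j+1} + 1 as long as the recursion has not stopped,
-- so it stops within V_0 + 1 rounds.
module Submission where

open import Defs
open import Data.List using (List; []; _∷_; map)
open import Data.List.Membership.Propositional using (_∈_)
open import Data.List.Relation.Unary.Any using (here; there)
open import Data.Nat using (ℕ)
open import Data.Product using (_,_; proj₁; proj₂; ∃-syntax)
open import Data.Sum using (inj₁; inj₂)
open import Relation.Binary.PropositionalEquality
  using (_≡_; refl; sym; trans; cong; cong₂; subst; subst₂)

infix 3 _⊢_

_⊢_ : List (Fm Γ) → Fm Γ → Set
Δ ⊢ φ = (HAω ∪ BI) ∣ Δ ⊢ φ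

ax : {Δ : List (Fm Γ)} {φ : Fm Γ} → HAω φ → Δ ⊢ φ
ax a = axiom (inj₁ a)

-- Renamings, substitutions and zero objects.

wk : Tm Γ σ → Tm (τ ∷ Γ) σ
wk = ren there

v₆ : ∀ {a b c d e f} → Tm (a ∷ b ∷ c ∷ d ∷ e ∷ f ∷ σ ∷ Γ) σ
v₆ = wk v₅

v₇ : ∀ {a b c d e f g} → Tm (a ∷ b ∷ c ∷ d ∷ e ∷ f ∷ g ∷ σ ∷ Γ) σ
v₇ = wk v₆

v₈ : ∀ {a b c d e f g h} → Tm (a ∷ b ∷ c ∷ d ∷ e ∷ f ∷ g ∷ h ∷ σ ∷ Γ) σ
v₈ = wk v₇

-- Stated for every renaming with a left inverse, because `there` becomes a lifted renaming under
-- `ƛ`.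
sub-ren : (κ : Ren Γ Γ′) (θ : Sub Γ′ Γ) →
          (∀ {σ} (x : σ ∈ Γ) → θ (κ x) ≡ var x) →
          (t : Tm Γ σ) → sub θ (ren κ t) ≡ t
sub-ren-ƛ : (κ : Ren Γ Γ′) (θ : Sub Γ′ Γ) →
            (∀ {σ} (x : σ ∈ Γ) → θ (κ x) ≡ var x) →
            ∀ {σ} (x : σ ∈ τ ∷ Γ) → lift-sub θ (lift-ren κ x) ≡ var x
sub-ren-ƛ κ θ inv (here refl) = refl
sub-ren-ƛ κ θ inv (there x)   = cong wk (inv x)

sub-ren κ θ inv (var x)      = inv x
sub-ren κ θ inv (ƛ t)        =
  cong ƛ (sub-ren (lift-ren κ) (lift-sub θ) (sub-ren-ƛ κ θ inv) t)
sub-ren κ θ inv (t · u)      = cong₂ _·_ (sub-ren κ θ inv t) (sub-ren κ θ inv u)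
sub-ren κ θ inv true         = refl
sub-ren κ θ inv false        = refl
sub-ren κ θ inv (if b t u)
  rewrite sub-ren κ θ inv b  = cong₂ (if b) (sub-ren κ θ inv t) (sub-ren κ θ inv u)
sub-ren κ θ inv zero         = refl
sub-ren κ θ inv (suc t)      = cong suc (sub-ren κ θ inv t)
sub-ren κ θ inv (rec z f n)
  rewrite sub-ren κ θ inv z  = cong₂ (rec z) (sub-ren κ θ inv f) (sub-ren κ θ inv n)
sub-ren κ θ inv (pair t u)   = cong₂ pair (sub-ren κ θ inv t) (sub-ren κ θ inv u)
sub-ren κ θ inv (fst t)      = cong fst (sub-ren κ θ inv t)
sub-ren κ θ inv (snd t)      = cong snd (sub-ren κ θ inv t)
sub-ren κ θ inv ⟨⟩           = refl
sub-ren κ θ inv (s ∷ʳ x)     = cong₂ _∷ʳ_ (sub-ren κ θ inv s) (sub-ren κ θ inv x)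
sub-ren κ θ inv (rec⋆ z f s)
  rewrite sub-ren κ θ inv z  = cong₂ (rec⋆ z) (sub-ren κ θ inv f) (sub-ren κ θ inv s)

sub-wk : (t : Tm Γ σ) (u : Tm Γ τ) → wk t [ u ] ≡ t
sub-wk t u = sub-ren there (var ▸ u) (λ _ → refl) t

ren-𝟎 : (κ : Ren Γ Γ′) (σ : Ty) → ren κ (𝟎 σ) ≡ 𝟎 σ
ren-𝟎 κ 𝔹       = refl
ren-𝟎 κ 𝐍       = refl
ren-𝟎 κ (σ ⊗ τ) = cong₂ pair (ren-𝟎 κ σ) (ren-𝟎 κ τ)
ren-𝟎 κ (σ ⇒ τ) = cong ƛ (ren-𝟎 (lift-ren κ) τ)
ren-𝟎 κ (σ ⋆)   = refl

sub-𝟎 : (θ : Sub Γ Γ′) (σ : Ty) → sub θ (𝟎 σ) ≡ 𝟎 σ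
sub-𝟎 θ 𝔹       = refl
sub-𝟎 θ 𝐍       = refl
sub-𝟎 θ (σ ⊗ τ) = cong₂ pair (sub-𝟎 θ σ) (sub-𝟎 θ τ)
sub-𝟎 θ (σ ⇒ τ) = cong ƛ (sub-𝟎 (lift-sub θ) τ)
sub-𝟎 θ (σ ⋆)   = refl

-- Provable equality

module _ {Γ : Ctx} {Δ : List (Fm Γ)} where

  ≐R : {t : Tm Γ σ} → Δ ⊢ t ≐ t
  ≐R = ax (≐-refl _)

  ≐-cong : (C : Tm (σ ∷ Γ) τ) {t u : Tm Γ σ} → Δ ⊢ t ≐ u → Δ ⊢ C [ t ] ≐ C [ u ]
  ≐-cong C {t} {u} e =
    subst (λ w → Δ ⊢ w ≐ C [ u ]) (sub-wk (C [ t ]) u)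
      (⊃E (⊃E (ax (≐-subst (wk (C [ t ]) ≐ C) t u)) e)
          (subst (λ w → Δ ⊢ w ≐ C [ t ]) (sym (sub-wk (C [ t ]) t)) ≐R))

  ≐-sym : {t u : Tm Γ σ} → Δ ⊢ t ≐ u → Δ ⊢ u ≐ t
  ≐-sym {t = t} {u} e =
    subst (λ w → Δ ⊢ u ≐ w) (sub-wk t u)
      (⊃E (⊃E (ax (≐-subst (v₀ ≐ wk t) t u)) e)
          (subst (λ w → Δ ⊢ t ≐ w) (sym (sub-wk t t)) ≐R))

  ≐-trans : {t u w : Tm Γ σ} → Δ ⊢ t ≐ u → Δ ⊢ u ≐ w → Δ ⊢ t ≐ w
  ≐-trans {t = t} {u} {w} e e′ =
    subst (λ a → Δ ⊢ a ≐ w) (sub-wk t w)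
      (⊃E (⊃E (ax (≐-subst (wk t ≐ v₀) u w)) e′)
          (subst (λ a → Δ ⊢ a ≐ u) (sym (sub-wk t u)) e))

  -- `C` contains weakened parameters, which `[ w ]` restores only up to `sub-wk`; `c` is the form
  -- with this done.
  frame : (C : Tm (σ ∷ Γ) τ) (c : Tm Γ σ → Tm Γ τ) → (∀ w → C [ w ] ≡ c w) →
          {t u : Tm Γ σ} → Δ ⊢ t ≐ u → Δ ⊢ c t ≐ c u
  frame C c C≡c e = subst₂ (λ a b → Δ ⊢ a ≐ b) (C≡c _) (C≡c _) (≐-cong C e)

  ·-cong : {f g : Tm Γ (σ ⇒ τ)} {t u : Tm Γ σ} →
           Δ ⊢ f ≐ g → Δ ⊢ t ≐ u → Δ ⊢ f · t ≐ g · u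
  ·-cong {g = g} {t} e e′ = ≐-trans
    (frame (v₀ · wk t) (_· t) (λ w → cong (w ·_) (sub-wk t w)) e)
    (frame (wk g · v₀) (g ·_) (λ w → cong (_· w) (sub-wk g w)) e′)

  pair-cong : {t t′ : Tm Γ σ} {u u′ : Tm Γ τ} →
              Δ ⊢ t ≐ t′ → Δ ⊢ u ≐ u′ → Δ ⊢ pair t u ≐ pair t′ u′
  pair-cong {t′ = t′} {u} e e′ = ≐-trans
    (frame (pair v₀ (wk u)) (λ w → pair w u) (λ w → cong (pair w) (sub-wk u w)) e)
    (frame (pair (wk t′) v₀) (pair t′) (λ w → cong (λ a → pair a w) (sub-wk t′ w)) e′)

  ∷ʳ-cong : {s s′ : Tm Γ (σ ⋆)} {t t′ : Tm Γ σ} →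
            Δ ⊢ s ≐ s′ → Δ ⊢ t ≐ t′ → Δ ⊢ s ∷ʳ t ≐ s′ ∷ʳ t′
  ∷ʳ-cong {s′ = s′} {t} e e′ = ≐-trans
    (frame (v₀ ∷ʳ wk t) (_∷ʳ t) (λ w → cong (w ∷ʳ_) (sub-wk t w)) e)
    (frame (wk s′ ∷ʳ v₀) (s′ ∷ʳ_) (λ w → cong (_∷ʳ w) (sub-wk s′ w)) e′)

  if-cong : {b b′ : Tm Γ 𝔹} {t t′ u u′ : Tm Γ σ} →
            Δ ⊢ b ≐ b′ → Δ ⊢ t ≐ t′ → Δ ⊢ u ≐ u′ → Δ ⊢ if b t u ≐ if b′ t′ u′
  if-cong {b′ = b} {t} {t′} {u} e e′ e″ = ≐-trans
    (frame (if v₀ (wk t) (wk u)) (λ w → if w t u)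
           (λ w → cong₂ (if w) (sub-wk t w) (sub-wk u w)) e) (≐-trans
    (frame (if (wk b) v₀ (wk u)) (λ w → if b w u)
           (λ w → cong₂ (λ a → if a w) (sub-wk b w) (sub-wk u w)) e′)
    (frame (if (wk b) (wk t′) v₀) (if b t′)
           (λ w → cong₂ (λ a c → if a c w) (sub-wk b w) (sub-wk t′ w)) e″))

  rec-cong : {z z′ : Tm Γ σ} {f f′ : Tm Γ (𝐍 ⇒ σ ⇒ σ)} {n n′ : Tm Γ 𝐍} →
             Δ ⊢ z ≐ z′ → Δ ⊢ f ≐ f′ → Δ ⊢ n ≐ n′ → Δ ⊢ rec z f n ≐ rec z′ f′ n′
  rec-cong {z′ = z} {f} {f′} {n} e e′ e″ = ≐-trans
    (frame (rec v₀ (wk f) (wk n)) (λ w → rec w f n)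
           (λ w → cong₂ (rec w) (sub-wk f w) (sub-wk n w)) e) (≐-trans
    (frame (rec (wk z) v₀ (wk n)) (λ w → rec z w n)
           (λ w → cong₂ (λ a → rec a w) (sub-wk z w) (sub-wk n w)) e′)
    (frame (rec (wk z) (wk f′) v₀) (rec z f′)
           (λ w → cong₂ (λ a c → rec a c w) (sub-wk z w) (sub-wk f′ w)) e″))

  rec⋆-cong : {z z′ : Tm Γ τ} {f f′ : Tm Γ (σ ⋆ ⇒ σ ⇒ τ ⇒ τ)} {s s′ : Tm Γ (σ ⋆)} →
              Δ ⊢ z ≐ z′ → Δ ⊢ f ≐ f′ → Δ ⊢ s ≐ s′ → Δ ⊢ rec⋆ z f s ≐ rec⋆ z′ f′ s′
  rec⋆-cong {z′ = z} {f} {f′} {s} e e′ e″ = ≐-trans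
    (frame (rec⋆ v₀ (wk f) (wk s)) (λ w → rec⋆ w f s)
           (λ w → cong₂ (rec⋆ w) (sub-wk f w) (sub-wk s w)) e) (≐-trans
    (frame (rec⋆ (wk z) v₀ (wk s)) (λ w → rec⋆ z w s)
           (λ w → cong₂ (λ a → rec⋆ a w) (sub-wk z w) (sub-wk s w)) e′)
    (frame (rec⋆ (wk z) (wk f′) v₀) (rec⋆ z f′)
           (λ w → cong₂ (λ a c → rec⋆ a c w) (sub-wk z w) (sub-wk f′ w)) e″))

-- Congruence under binders comes from `ext`: both abstractions are applied to the fresh variable
-- and β-reduced.
ƛ-cong : {Δ : List (Fm Γ)} {t u : Tm (σ ∷ Γ) τ} →
         map (renF there) Δ ⊢ t ≐ u → Δ ⊢ ƛ t ≐ ƛ u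
ƛ-cong {Δ = Δ} {t} {u} e = ⊃E (ax (ext (ƛ t) (ƛ u)))
  (∀I (≐-trans (β-wk t) (≐-trans e (≐-sym (β-wk u)))))
  where
  β-wk : ∀ w → map (renF there) Δ ⊢ wk (ƛ w) · v₀ ≐ w
  β-wk w = subst (λ a → map (renF there) Δ ⊢ wk (ƛ w) · v₀ ≐ a)
    (sub-ren (lift-ren there) (var ▸ v₀) (λ { (here refl) → refl ; (there x) → refl }) w)
    (ax (β (ren (lift-ren there) w) v₀))

-- Conversion by reflection: terms with the same normal form are provably
-- equal.

-- The equation is kept for every `Δ`, since `ƛ-cong` asks for it over weakened hypotheses.
Reduct : Tm Γ σ → Set
Reduct {Γ} t = ∃[ u ] ((Δ : List (Fm Γ)) → Δ ⊢ t ≐ u)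

contract-· : (f : Tm Γ (σ ⇒ τ)) (t : Tm Γ σ) → Reduct (f · t)
contract-· (ƛ t) u = t [ u ] , λ _ → ax (β t u)
contract-· f     u = f · u , λ _ → ≐R

contract-if : (b : Tm Γ 𝔹) (t u : Tm Γ σ) → Reduct (if b t u)
contract-if true  t u = t , λ _ → ax (if-true t u)
contract-if false t u = u , λ _ → ax (if-false t u)
contract-if b     t u = if b t u , λ _ → ≐R

contract-rec : (z : Tm Γ σ) (f : Tm Γ (𝐍 ⇒ σ ⇒ σ)) (n : Tm Γ 𝐍) → Reduct (rec z f n)
contract-rec z f zero    = z , λ _ → ax (rec-zero z f)
contract-rec z f (suc n) = f · n · rec z f n , λ _ → ax (rec-suc z f n)
contract-rec z f n       = rec z f n , λ _ → ≐R

contract-fst : (p : Tm Γ (σ ⊗ τ)) → Reduct (fst p)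
contract-fst (pair t u) = t , λ _ → ax (fst-pair t u)
contract-fst p          = fst p , λ _ → ≐R

contract-snd : (p : Tm Γ (σ ⊗ τ)) → Reduct (snd p)
contract-snd (pair t u) = u , λ _ → ax (snd-pair t u)
contract-snd p          = snd p , λ _ → ≐R

contract-rec⋆ : (z : Tm Γ τ) (f : Tm Γ (σ ⋆ ⇒ σ ⇒ τ ⇒ τ)) (s : Tm Γ (σ ⋆)) →
                Reduct (rec⋆ z f s)
contract-rec⋆ z f ⟨⟩       = z , λ _ → ax (rec⋆-⟨⟩ z f)
contract-rec⋆ z f (s ∷ʳ x) = f · s · x · rec⋆ z f s , λ _ → ax (rec⋆-∷ʳ z f s x)
contract-rec⋆ z f s        = rec⋆ z f s , λ _ → ≐R

infixl 4 _⨾_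

_⨾_ : {t u : Tm Γ σ} → ((Δ : List (Fm Γ)) → Δ ⊢ t ≐ u) → Reduct u → Reduct t
e ⨾ (u , e′) = u , λ Δ → ≐-trans (e Δ) (e′ Δ)

-- Redexes created by a contraction wait for the next round, so the recursion is structural.
develop : (t : Tm Γ σ) → Reduct t
develop (var x) = var x , λ _ → ≐R
develop (ƛ t) with develop t
... | t′ , e = ƛ t′ , λ Δ → ƛ-cong (e _)
develop (t · u) with develop t | develop u
... | t′ , e | u′ , e′ = (λ Δ → ·-cong (e Δ) (e′ Δ)) ⨾ contract-· t′ u′
develop true  = true , λ _ → ≐R
develop false = false , λ _ → ≐R
develop (if b t u) with develop b | develop t | develop u
... | b′ , e | t′ , e′ | u′ , e″ =
  (λ Δ → if-cong (e Δ) (e′ Δ) (e″ Δ)) ⨾ contract-if b′ t′ u′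
develop zero = zero , λ _ → ≐R
develop (suc t) with develop t
... | t′ , e = suc t′ , λ Δ → ≐-cong (suc v₀) (e Δ)
develop (rec z f n) with develop z | develop f | develop n
... | z′ , e | f′ , e′ | n′ , e″ =
  (λ Δ → rec-cong (e Δ) (e′ Δ) (e″ Δ)) ⨾ contract-rec z′ f′ n′
develop (pair t u) with develop t | develop u
... | t′ , e | u′ , e′ = pair t′ u′ , λ Δ → pair-cong (e Δ) (e′ Δ)
develop (fst t) with develop t
... | t′ , e = (λ Δ → ≐-cong (fst v₀) (e Δ)) ⨾ contract-fst t′
develop (snd t) with develop t
... | t′ , e = (λ Δ → ≐-cong (snd v₀) (e Δ)) ⨾ contract-snd t′
develop ⟨⟩ = ⟨⟩ , λ _ → ≐R
develop (s ∷ʳ x) with develop s | develop x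
... | s′ , e | x′ , e′ = s′ ∷ʳ x′ , λ Δ → ∷ʳ-cong (e Δ) (e′ Δ)
develop (rec⋆ z f s) with develop z | develop f | develop s
... | z′ , e | f′ , e′ | s′ , e″ =
  (λ Δ → rec⋆-cong (e Δ) (e′ Δ) (e″ Δ)) ⨾ contract-rec⋆ z′ f′ s′

normalise : ℕ → (t : Tm Γ σ) → Reduct t
normalise ℕ.zero    t = t , λ _ → ≐R
normalise (ℕ.suc k) t with develop t
... | t′ , e = e ⨾ normalise k t′

-- Eight developments normalise every term to which conv is applied below.
nf : Tm Γ σ → Tm Γ σ
nf t = proj₁ (normalise 8 t)

conv : {Δ : List (Fm Γ)} {t u : Tm Γ σ} → nf t ≡ nf u → Δ ⊢ t ≐ u
conv {Δ = Δ} {t} {u} eq = ≐-trans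
  (subst (λ w → Δ ⊢ t ≐ w) eq (proj₂ (normalise 8 t) Δ))
  (≐-sym (proj₂ (normalise 8 u) Δ))

-- Applies an equation to a subterm that may be visible only up to conversion; `C` marks its place.
rewr : {Δ : List (Fm Γ)} (C : Tm (σ ∷ Γ) τ) {a b : Tm Γ σ} {t : Tm Γ τ} →
       Δ ⊢ a ≐ b → nf t ≡ nf (C [ a ]) → Δ ⊢ t ≐ C [ b ]
rewr C e eq = ≐-trans (conv eq) (≐-cong C e)


-- Derived rules of the logic.

cut : {Δ : List (Fm Γ)} {φ ψ : Fm Γ} → Δ ⊢ φ → φ ∷ Δ ⊢ ψ → Δ ⊢ ψ
cut d e = ⊃E (⊃I e) d

h₀ : {Δ : List (Fm Γ)} {φ : Fm Γ} → φ ∷ Δ ⊢ φ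
h₀ = hyp (here refl)

h₁ : {Δ : List (Fm Γ)} {φ ψ : Fm Γ} → ψ ∷ φ ∷ Δ ⊢ φ
h₁ = hyp (there (here refl))

h₂ : {Δ : List (Fm Γ)} {φ ψ χ : Fm Γ} → χ ∷ ψ ∷ φ ∷ Δ ⊢ φ
h₂ = hyp (there (there (here refl)))

h₃ : {Δ : List (Fm Γ)} {φ ψ χ ω : Fm Γ} → ω ∷ χ ∷ ψ ∷ φ ∷ Δ ⊢ φ
h₃ = hyp (there (there (there (here refl))))

induction : {Δ : List (Fm Γ)} (φ : Fm (𝐍 ∷ Γ)) →
            Δ ⊢ φ [ zero ]F → φ ∷ map (renF there) Δ ⊢ φ ⟨ there ∣ suc v₀ ⟩ →
            Δ ⊢ ∀̇ 𝐍 φ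
induction φ base step = ⊃E (⊃E (ax (ind-𝐍 φ)) base) (∀I (⊃I step))

𝔹-cases : {Δ : List (Fm Γ)} (b : Tm Γ 𝔹) → Δ ⊢ b ≐ true ∨̇ b ≐ false
𝔹-cases b =
  ∀E (⊃E (⊃E (ax (ind-𝔹 (v₀ ≐ true ∨̇ v₀ ≐ false))) (∨I₁ ≐R)) (∨I₂ ≐R)) b

module _ {Δ : List (Fm Γ)} {b : Tm Γ 𝔹} where

  if-≐true : {t u : Tm Γ σ} → Δ ⊢ b ≐ true → Δ ⊢ if b t u ≐ t
  if-≐true e = ≐-trans (if-cong e ≐R ≐R) (ax (if-true _ _))

  if-≐false : {t u : Tm Γ σ} → Δ ⊢ b ≐ false → Δ ⊢ if b t u ≐ u
  if-≐false e = ≐-trans (if-cong e ≐R ≐R) (ax (if-false _ _))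

-- Conversion is stuck at an undecided `if`, so the context is moved past it by cases.
if-distrib : {Δ : List (Fm Γ)} (C : Tm (σ ∷ Γ) τ) {b : Tm Γ 𝔹} {t u : Tm Γ σ} →
             Δ ⊢ C [ if b t u ] ≐ if b (C [ t ]) (C [ u ])
if-distrib C {b} = ∨E (𝔹-cases b)
  (≐-trans (≐-cong C (if-≐true h₀)) (≐-sym (if-≐true h₀)))
  (≐-trans (≐-cong C (if-≐false h₀)) (≐-sym (if-≐false h₀)))

-- Round numbers n + |s|, outcome functions after s, and shifted sequences.

len : Tm Γ 𝐍 → Tm Γ (σ ⋆) → Tm Γ 𝐍
len n s = rec⋆ n (ƛ (ƛ (ƛ (suc v₀)))) s

-- q_s
restrict : Tm Γ ((𝐍 ⇒ σ) ⇒ τ) → Tm Γ (σ ⋆) → Tm Γ ((𝐍 ⇒ σ) ⇒ τ)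
restrict q s = rec⋆ q (ƛ (ƛ (ƛ (slice · v₀ · v₁)))) s

-- α behind n copies of α(0), so that index n + j holds α(j).
delay : Tm Γ 𝐍 → Tm Γ (𝐍 ⇒ σ) → Tm Γ (𝐍 ⇒ σ)
delay n α = rec α (ƛ (ƛ (cons · (wk (wk α) · zero) · v₀))) n

len-zero : {Δ : List (Fm Γ)} →
           Δ ⊢ ∀̇ (𝐍 ⇒ σ) (∀̇ 𝐍 (len zero (initial · v₁ · v₀) ≐ v₀))
len-zero = ∀I (induction (len zero (initial · v₁ · v₀) ≐ v₀)
  (conv refl) (rewr (suc v₀) h₀ refl))

len-suc : {Δ : List (Fm Γ)} →
          Δ ⊢ ∀̇ (𝐍 ⇒ σ) (∀̇ 𝐍 (∀̇ 𝐍
                (len (suc v₁) (initial · v₂ · v₀) ≐ suc (len v₁ (initial · v₂ · v₀)))))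
len-suc = ∀I (∀I (induction
  (len (suc v₁) (initial · v₂ · v₀) ≐ suc (len v₁ (initial · v₂ · v₀)))
  (conv refl) (≐-trans (rewr (suc v₀) h₀ refl) (conv refl))))

delay-len : {Δ : List (Fm Γ)} →
            Δ ⊢ ∀̇ (𝐍 ⇒ σ) (∀̇ 𝐍 (∀̇ 𝐍
                  (delay v₁ v₂ · len v₁ (initial · v₂ · v₀) ≐ v₂ · v₀)))
delay-len = ∀I (induction
  (∀̇ 𝐍 (delay v₁ v₂ · len v₁ (initial · v₂ · v₀) ≐ v₂ · v₀))
  (∀I (rewr (v₂ · v₀) (∀E (∀E len-zero v₁) v₀) refl))
  (∀I (≐-trans
    (rewr (delay (suc v₂) v₃ · v₀) (∀E (∀E (∀E len-suc v₂) v₁) v₀) refl)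
    (≐-trans (conv refl) (∀E h₀ v₀)))))

module _ (X R : Ty) where

  Seq Y Bar : Ty
  Seq = 𝐍 ⇒ X
  Y   = Seq ⊗ 𝐍
  Bar = (Y ⇒ 𝐍) ⇒ 𝐍 ⇒ (𝐍 ⇒ K Y X) ⇒ (Seq ⇒ Y) ⇒ Y

  -- The zero sequence of an arbitrary type is stuck under substitution, hence
  -- the parameter z, which is a variable until the last step. Likewise the
  -- lemmas are closed formulas, whose instances at concrete terms compute.
  IsEpq : Tm ((Seq ⇒ Y) ∷ (𝐍 ⇒ K Y X) ∷ 𝐍 ∷ (Y ⇒ 𝐍) ∷ Γ) Seq → Tm Γ Bar → Fm Γ
  IsEpq z F = ∀̇ (Y ⇒ 𝐍) (∀̇ 𝐍 (∀̇ (𝐍 ⇒ K Y X) (∀̇ (Seq ⇒ Y)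
    (wk (wk (wk (wk F))) · v₃ · v₂ · v₁ · v₀
     ≐ if (less · (v₃ · (v₀ · z)) · v₂) (v₀ · z)
          (v₁ · v₂ · ƛ (wk (wk (wk (wk (wk F)))) · v₄ · suc v₃ · v₂ · (slice · v₁ · v₀)))))))

  GivenEpq : Fm (Bar ∷ Seq ∷ Γ) → Fm Γ
  GivenEpq φ = ∀̇ Seq (∀̇ Bar (IsEpq v₅ v₀ ⊃ φ))

  givenEpq : {Δ : List (Fm Γ)} {φ : Fm (Bar ∷ Seq ∷ Γ)} →
    IsEpq v₅ v₀ ∷ map (renF there) (map (renF there) Δ) ⊢ φ → Δ ⊢ GivenEpq φ
  givenEpq d = ∀I (∀I (⊃I d))

  -- The recursion of `epq` stops along every sequence.

  stops : Tm Γ Seq → Tm Γ (Y ⇒ 𝐍) → Tm Γ 𝐍 → Tm Γ (Seq ⇒ Y) → Tm Γ (X ⋆) → Tm Γ 𝔹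
  stops z L n Q s = less · (L · (restrict Q s · z)) · len n s

  -- `epq` indexes quantifiers by the absolute round, which starts at n; hence `delay`.
  counter : Tm Γ Seq → Tm Γ 𝐍 → Tm Γ Seq → Tm Γ (𝐍 ⇒ K Y X)
  counter z n α =
    ƛ (ƛ (pair (wk (wk z)) (suc (snd (v₀ · (wk (wk (delay n α)) · v₁))))))

  count : Tm Γ Seq → Tm Γ Bar → Tm Γ (Y ⇒ 𝐍) → Tm Γ 𝐍 → Tm Γ (Seq ⇒ Y) → Tm Γ Seq →
          Tm Γ 𝐍 → Tm Γ 𝐍
  count z F L n Q α j =
    snd (F · L · len n (initial · α · j) · counter z n α · restrict Q (initial · α · j))

  count-step : {Δ : List (Fm Γ)} → Δ ⊢ GivenEpq
    (∀̇ (Y ⇒ 𝐍) (∀̇ 𝐍 (∀̇ (Seq ⇒ Y) (∀̇ Seq (∀̇ 𝐍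
      (stops v₆ v₄ v₃ v₂ (initial · v₁ · v₀) ≐ true ∨̇
       count v₆ v₅ v₄ v₃ v₂ v₁ v₀ ≐ suc (count v₆ v₅ v₄ v₃ v₂ v₁ (suc v₀))))))))
  count-step = givenEpq (∀I (∀I (∀I (∀I (∀I
    (∨E (𝔹-cases (stops v₆ v₄ v₃ v₂ (initial · v₁ · v₀)))
      (∨I₁ h₀)
      (∨I₂ (≐-trans
        (≐-cong (snd v₀) (≐-trans
          (∀E (∀E (∀E (∀E h₁ v₄) (len v₃ (initial · v₁ · v₀))) (counter v₆ v₃ v₁))
              (restrict v₂ (initial · v₁ · v₀)))
          (if-≐false h₀)))
        (≐-trans
          -- The quantifier of round n + j plays α(j) by `delay-len`; slicing by it turns [α](j)
          -- into [α](j+1).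
          (rewr (suc (snd (v₆ · v₅ · suc (len v₄ (initial · v₂ · v₁)) · counter v₇ v₄ v₂
                             · (slice · restrict v₃ (initial · v₂ · v₁) · v₀))))
                (∀E (∀E (∀E delay-len v₁) v₃) v₀) refl)
          (conv refl))))))))))

  -- Induction on the value v of V_j, for all j at once, as the step passes from j to j + 1. For v =
  -- 0 the recursion must have stopped at j, a successor being nonzero.
  eventually-stops : {Δ : List (Fm Γ)} → Δ ⊢ GivenEpq
    (∀̇ (Y ⇒ 𝐍) (∀̇ 𝐍 (∀̇ (Seq ⇒ Y) (∀̇ Seq
      (∃̇ 𝐍 (stops v₆ v₄ v₃ v₂ (initial · v₁ · v₀) ≐ true))))))
  eventually-stops = givenEpq (∀I (∀I (∀I (∀I
    (cut (∀E (∀E (∀E (∀E (⊃E (∀E (∀E count-step v₅) v₄) h₀) v₃) v₂) v₁) v₀)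
      (⊃E (∀E (∀E (induction
        (∀̇ 𝐍 (count v₇ v₆ v₅ v₄ v₃ v₂ v₀ ≐ v₁ ⊃
              ∃̇ 𝐍 (stops v₈ v₆ v₅ v₄ (initial · v₃ · v₀) ≐ true)))
        (∀I (⊃I (∨E (∀E h₁ v₀)
          (∃I v₀ h₀)
          (⊥E (⊃E (ax (suc≢zero _)) (≐-trans (≐-sym h₀) h₁))))))
        (∀I (⊃I (∨E (∀E h₂ v₀)
          (∃I v₀ h₀)
          (⊃E (∀E h₂ (suc v₀)) (⊃E (ax (suc-inj _ _)) (≐-trans (≐-sym h₀) h₁)))))))
        (count v₅ v₄ v₃ v₂ v₁ v₀ zero)) zero)
        ≐R))))))

  -- Plays computed by `epq`.

  control : Tm Γ (R ⇒ 𝐍) → Tm Γ (Seq ⇒ R) → Tm Γ (Y ⇒ 𝐍)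
  control ℓ q = ƛ (wk ℓ · (wk q · fst v₀))

  quantifiers : Tm Γ (𝐍 ⇒ J R X) → Tm Γ (Seq ⇒ R) → Tm Γ (𝐍 ⇒ K Y X)
  quantifiers ε q = ƛ (ƛ (v₀ · (wk (wk ε) · v₁ · ƛ (wk (wk (wk q)) · fst (v₁ · v₀)))))

  -- `q` judges finished plays and is fixed through the recursion; `Q`, which completes the play
  -- from the remaining moves, is restricted in each round.
  play : Tm Γ Bar → Tm Γ (R ⇒ 𝐍) → Tm Γ 𝐍 → Tm Γ (𝐍 ⇒ J R X) → Tm Γ (Seq ⇒ R) →
         Tm Γ (Seq ⇒ Y) → Tm Γ Seq
  play F ℓ n ε q Q = fst (F · control ℓ q · n · quantifiers ε q · Q)

  -- If f(y) is the play resulting from y, this is the play for the y selected by ε_n. Prefixing x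
  -- to the one for q_x and f gives, by conversion, the one for q and y ↦ x * f(y).
  move : Tm Γ 𝐍 → Tm Γ (𝐍 ⇒ J R X) → Tm Γ (Seq ⇒ R) → Tm Γ (X ⇒ Seq) → Tm Γ Seq
  move n ε q f = f · (ε · n · ƛ (wk q · (wk f · v₀)))

  embed : Tm Γ (Seq ⇒ Y)
  embed = ƛ (pair v₀ zero)

  prefix : Tm Γ X → Tm Γ (Seq ⇒ Y) → Tm Γ (Seq ⇒ Y)
  prefix x Q = ƛ (pair (cons · wk x · fst (wk Q · v₀)) zero)

  play-unfold : {Δ : List (Fm Γ)} → Δ ⊢ GivenEpq
    (∀̇ (R ⇒ 𝐍) (∀̇ 𝐍 (∀̇ (𝐍 ⇒ J R X) (∀̇ (Seq ⇒ R) (∀̇ (Seq ⇒ Y)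
      (play v₅ v₄ v₃ v₂ v₁ v₀
       ≐ if (less · (v₄ · (v₁ · fst (v₀ · v₆))) · v₃)
            (fst (v₀ · v₆))
            (move v₃ v₂ v₁ (ƛ (play v₆ v₅ (suc v₄) v₃ v₂ (slice · v₁ · v₀))))))))))
  play-unfold = givenEpq (∀I (∀I (∀I (∀I (∀I
    (≐-trans
      (≐-cong (fst v₀)
        (∀E (∀E (∀E (∀E h₀ (control v₄ v₁)) v₃) (quantifiers v₂ v₁)) v₀))
      (≐-trans (if-distrib (fst v₀)) (conv refl))))))))

  -- Both sides unfold to an `if` with the same test, as q_x(α) = q(x * α). The hypothesis retains
  -- the `if`s, so it can be met by a true test or by equal continuations.
  play-prefix-step : {Δ : List (Fm Γ)} → Δ ⊢ GivenEpq
    (∀̇ (R ⇒ 𝐍) (∀̇ 𝐍 (∀̇ (𝐍 ⇒ J R X) (∀̇ (Seq ⇒ R) (∀̇ X (∀̇ (Seq ⇒ Y)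
      (let z = v₇; F = v₆; ℓ = v₅; n = v₄; ε = v₃; q = v₂; x = v₁; Q = v₀
           b = less · (ℓ · (slice · q · x · fst (Q · z))) · n
           α = cons · x · fst (Q · z) in
       if b α (move n ε q (ƛ (play v₇ v₆ (suc v₅) v₄ v₃ (prefix v₂ (slice · v₁ · v₀)))))
       ≐ if b α (move n ε q (ƛ (cons · v₂ · play v₇ v₆ (suc v₅) v₄ (slice · v₃ · v₂)
                                                 (slice · v₁ · v₀))))
       ⊃ play F ℓ n ε q (prefix x Q) ≐ cons · x · play F ℓ n ε (slice · q · x) Q)))))))
  play-prefix-step = givenEpq (∀I (∀I (∀I (∀I (∀I (∀I (⊃I
    (≐-trans
      (∀E (∀E (∀E (∀E (∀E (⊃E (∀E (∀E play-unfold v₇) v₆) h₁) v₅) v₄) v₃) v₂) (prefix v₁ v₀))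
      (≐-trans (conv refl) (≐-trans h₀ (≐-trans (conv refl)
        (≐-sym (≐-trans
          (≐-cong (cons · v₂ · v₀)
            (∀E (∀E (∀E (∀E (∀E (⊃E (∀E (∀E play-unfold v₇) v₆) h₁) v₅) v₄) v₃)
                (slice · v₂ · v₁)) v₀))
          (if-distrib (cons · v₂ · v₀)))))))))))))))

  -- The property of s is this equation at round n + |s| with `restrict embed s` for `embed`; note
  -- that `slice · embed · x` converts to `prefix x embed`.
  play-prefix : {Δ : List (Fm Γ)} → Δ ⊢ GivenEpq
    (∀̇ (R ⇒ 𝐍) (∀̇ 𝐍 (∀̇ (𝐍 ⇒ J R X) (∀̇ (Seq ⇒ R) (∀̇ X
      (play v₅ v₄ v₃ v₂ v₁ (slice · embed · v₀)
       ≐ cons · v₀ · play v₅ v₄ v₃ v₂ (slice · v₁ · v₀) embed))))))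
  play-prefix = givenEpq (∀I (∀I (∀I (∀I (∀I
    (cut (⊃E (∀E (∀E play-prefix-step v₆) v₅) h₀)
    (cut (⊃E (∀E (∀E eventually-stops v₆) v₅) h₁)
    (≐-trans (conv refl) (≐-trans
      (⊃E (⊃E (⊃E (axiom (inj₂ (bi
            (zero ≐ zero)
            (play v₆ v₅ (len v₄ v₀) v₃ v₂ (prefix v₁ (restrict embed v₀))
             ≐ cons · v₁ · play v₆ v₅ (len v₄ v₀) v₃ (slice · v₂ · v₁) (restrict embed v₀)))))
        ≐R)
        (∀I (⊃I (∃E
          -- Stopping for q_x after [α](j) converts to the common test of `play-prefix-step`, so
          -- both `if`s take the same first branch.
          (∀E (∀E (∀E (∀E h₁ (control v₅ (slice · v₂ · v₁))) v₄) embed) v₀)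
          (∃I v₀ (⊃E
            (∀E (∀E (∀E (∀E (∀E (∀E h₃ v₆) (len v₅ (initial · v₁ · v₀))) v₄) v₃) v₂)
                (restrict embed (initial · v₁ · v₀)))
            (≐-trans (if-≐true (≐-trans (conv refl) h₀))
                     (≐-sym (if-≐true (≐-trans (conv refl) h₀))))))))))
        (∀I (⊃I (⊃I (⊃E
          (∀E (∀E (∀E (∀E (∀E (∀E h₃ v₅) (len v₄ v₀)) v₃) v₂) v₁)
              (restrict embed v₀))
          -- The sides differ only in the continuation inside `move`, where the induction hypothesis
          -- at s * y applies.
          (if-cong ≐R ≐R (≐-cong (move (len v₅ v₁) v₄ v₃ v₀)
            (ƛ-cong (≐-trans (conv refl) (≐-trans (⊃E (∀E h₀ v₀) ≐R) (conv refl)))))))))))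
      (conv refl))))))))))

  -- The term defining `eps`, and its equation.

  epsFromEpq : Tm Γ (Bar ⇒ (R ⇒ 𝐍) ⇒ 𝐍 ⇒ (𝐍 ⇒ J R X) ⇒ (Seq ⇒ R) ⇒ Seq)
  epsFromEpq = ƛ (ƛ (ƛ (ƛ (ƛ (play v₄ v₃ v₂ v₁ v₀ embed)))))

  IsEps : Tm ((Seq ⇒ R) ∷ (𝐍 ⇒ J R X) ∷ 𝐍 ∷ (R ⇒ 𝐍) ∷ Γ) Seq →
          Tm Γ ((R ⇒ 𝐍) ⇒ 𝐍 ⇒ (𝐍 ⇒ J R X) ⇒ (Seq ⇒ R) ⇒ Seq) → Fm Γ
  IsEps z E = ∀̇ (R ⇒ 𝐍) (∀̇ 𝐍 (∀̇ (𝐍 ⇒ J R X) (∀̇ (Seq ⇒ R)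
    (let E₄ = wk (wk (wk (wk E)))
         c  = v₁ · v₂ · ƛ (slice · v₁ · v₀
                · (wk E₄ · v₄ · suc v₃ · v₂ · (slice · v₁ · v₀)))
     in E₄ · v₃ · v₂ · v₁ · v₀
        ≐ if (less · (v₃ · (v₀ · z)) · v₂) z
             (cons · c · (E₄ · v₃ · suc v₂ · v₁ · (slice · v₀ · c)))))))

  -- After `play-prefix` rewrites each continuation to x * (play for q_x), the selected move inside
  -- `move` is c.
  epsFromEpq-isEps : {Δ : List (Fm Γ)} → Δ ⊢ GivenEpq (IsEps v₅ (epsFromEpq · v₀))
  epsFromEpq-isEps = givenEpq (∀I (∀I (∀I (∀I
    (≐-trans (conv refl) (≐-trans
      (∀E (∀E (∀E (∀E (∀E (⊃E (∀E (∀E play-unfold v₅) v₄) h₀) v₃) v₂) v₁) v₀) embed)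
      (≐-trans
        (if-cong ≐R ≐R (≐-cong (move v₃ v₂ v₁ v₀) (ƛ-cong
          (∀E (∀E (∀E (∀E (∀E (⊃E (∀E (∀E play-prefix v₆) v₅) h₀) v₄) (suc v₃)) v₂) v₁) v₀))))
        (conv refl))))))))

-- Instantiating z passes `∀̇ Bar` and four further quantifiers, each adding a weakening.
wk⁵-𝟎 : ∀ {a b c d e} σ →
  wk {τ = a} (wk {τ = b} (wk {τ = c} (wk {τ = d} (wk {Γ} {τ = e} (𝟎 σ))))) ≡ 𝟎 σ
wk⁵-𝟎 σ = trans (cong wk (trans (cong wk (trans (cong wk (trans (cong wk
  (ren-𝟎 there σ)) (ren-𝟎 there σ))) (ren-𝟎 there σ))) (ren-𝟎 there σ))) (ren-𝟎 there σ)

theorem3p7 : epq ≥T eps over (HAω ∪ BI)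
theorem3p7 (X , R) = (X , Y X R) , epsFromEpq X R ,
  ⊃E (subst₂ (λ z z′ → Functional.eqn epq (X , Y X R) ∷ [] ⊢
                      IsEpq X R z v₀ ⊃ IsEps X R z′ (epsFromEpq X R · v₀))
        (instance-𝟎 _) (trans (instance-𝟎 _) (sym (sub-𝟎 _ (𝐍 ⇒ X))))
        (∀E (∀E (epsFromEpq-isEps X R) (𝟎 (𝐍 ⇒ X))) v₀))
     h₀
  where
  instance-𝟎 : ∀ {a b c d e} (θ : Sub (a ∷ b ∷ c ∷ d ∷ e ∷ Γ) Γ′) →
    sub θ (wk (wk (wk (wk (wk (𝟎 (𝐍 ⇒ X))))))) ≡ 𝟎 (𝐍 ⇒ X)
  instance-𝟎 θ = trans (cong (sub θ) (wk⁵-𝟎 (𝐍 ⇒ X))) (sub-𝟎 θ (𝐍 ⇒ X))
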